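{- Let $n\ge 5$ and let $G$ be a tree on $n$ vertices with $G\not\cong P_n$. Then $\mathrm{irr}_t(G)\ge 4n-10$. Equality holds if and only if the degree sequence of $G$ is $(3,2,\ldots,2,1,1,1)$, i.e. $G$ has exactly one vertex of degree $3$, exactly $n-4$ vertices of degree $2$ and exactly $3$ vertices of degree $1$.
   Context: For a graph $G=(V,E)$ and $w\in V$, $d_G(w)$ is the degree of $w$. The total irregularity is $\mathrm{irr}_t(G)=\frac12\sum_{x,y\in V}|d_G(x)-d_G(y)|$, where the sum runs over all ordered pairs of vertices. $P_n$ is the path on $n$ vertices. Degree sequences are listed in nonincreasing order. -}

module Defs where

open import Data.Fin.Base using (Fin; zero; suc; toℕ)
open import Data.List.Base using (List; _∷_; [_]; _++_; allFin; filter; length; map)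
open import Data.List.Relation.Unary.Linked using (Linked)
open import Data.List.Relation.Unary.Unique.Propositional using (Unique)
open import Data.Nat.Base using (ℕ; zero; suc; _+_; _*_; _≤_; _/_; ∣_-_∣)
open import Data.Nat.Divisibility using (_∣_; divides; ∣m∣n⇒∣m+n; m∣m*n)
open import Data.Nat.DivMod using (m/n*n≡m)
open import Data.Nat.Properties
  using (_≟_; +-0-commutativeMonoid; ≤-decTotalOrder; ∣-∣-comm; ∣n-n∣≡0; 1+n≢n)
open import Data.Nat.Solver using (module +-*-Solver)
open import Data.Product.Base using (Σ)
open import Data.Sum.Base using (_⊎_; inj₁; inj₂; swap)
open import Function.Bundles using (_↔_; _⇔_; module Inverse)
open import Level using (0ℓ)
open import Relation.Binary.Construct.Closure.ReflexiveTransitive using (Star)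
open import Relation.Binary.Core using (Rel)
open import Relation.Binary.Definitions using (Decidable; Symmetric)
open import Relation.Binary.Properties.DecTotalOrder ≤-decTotalOrder using (≥-decTotalOrder)
open import Relation.Binary.PropositionalEquality
  using (_≡_; refl; sym; cong; cong₂; subst; module ≡-Reasoning)
open import Relation.Nullary.Decidable using (_⊎-dec_)
open import Relation.Nullary.Negation using (¬_)

open import Algebra.Properties.CommutativeMonoid.Sum +-0-commutativeMonoid public
  using (∑-distrib-+; ∑-comm; sum-cong-≗; sum-syntax)
open import Data.List.Sort ≥-decTotalOrder public
  using () renaming (sort to sort-nonincreasing)

record Graph (n : ℕ) : Set₁ where
  field
    Adj    : Rel (Fin n) 0ℓ
    adj?   : Decidable Adj
    symm   : Symmetric Adj
    irrefl : ∀ {v} → ¬ Adj v v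

open Graph public

infix 4 _≅_

_≅_ : ∀ {m n} → Graph m → Graph n → Set
_≅_ {m} {n} G H =
  Σ (Fin m ↔ Fin n) λ φ →
    ∀ u v → Adj G u v ⇔ Adj H (Inverse.to φ u) (Inverse.to φ v)

P : ∀ n → Graph n
P n = record
  { Adj    = λ u v → toℕ v ≡ suc (toℕ u) ⊎ toℕ u ≡ suc (toℕ v)
  ; adj?   = λ u v → (toℕ v ≟ suc (toℕ u)) ⊎-dec (toℕ u ≟ suc (toℕ v))
  ; symm   = swap
  ; irrefl = λ { (inj₁ eq) → 1+n≢n (sym eq) ; (inj₂ eq) → 1+n≢n (sym eq) }
  }

Connected : ∀ {n} → Graph n → Set
Connected G = ∀ u v → Star (Adj G) u v

-- The cycle through the distinct vertices v, v₁, …, vₖ (k ≥ 2) and back to v.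
record Cycle {n} (G : Graph n) : Set where
  field
    v        : Fin n
    vs       : List (Fin n)
    length≥2 : 2 ≤ length vs
    distinct : Unique (v ∷ vs)
    closed   : Linked (Adj G) (v ∷ vs ++ [ v ])

record IsTree {n} (G : Graph n) : Set where
  field
    connected : Connected G
    acyclic   : ¬ Cycle G

deg : ∀ {n} → Graph n → Fin n → ℕ
deg {n} G v = length (filter (adj? G v) (allFin n))

degreeSequence : ∀ {n} → Graph n → List ℕ
degreeSequence {n} G = sort-nonincreasing (map (deg G) (allFin n))

∑∣Δdeg∣ : ∀ {n} → Graph n → ℕ
∑∣Δdeg∣ {n} G = ∑[ x < n ] ∑[ y < n ] ∣ deg G x - deg G y ∣

-- The division is exact: see irrₜ-exact.
irrₜ : ∀ {n} → Graph n → ℕ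
irrₜ G = ∑∣Δdeg∣ G / 2

private
  2∣∑∑ : ∀ {n} (f : Fin n → Fin n → ℕ) →
         (∀ x y → f x y ≡ f y x) → (∀ x → f x x ≡ 0) →
         2 ∣ ∑[ x < n ] ∑[ y < n ] f x y
  2∣∑∑ {zero}  f f-sym f-diag = divides 0 refl
  2∣∑∑ {suc n} f f-sym f-diag =
    subst (2 ∣_) (sym eq) (∣m∣n⇒∣m+n (m∣m*n row)
      (2∣∑∑ g (λ x y → f-sym (suc x) (suc y)) (λ x → f-diag (suc x))))
    where
    open ≡-Reasoning
    g : Fin n → Fin n → ℕ
    g x y = f (suc x) (suc y)
    row   = ∑[ y < n ] f zero (suc y)
    inner = ∑[ x < n ] ∑[ y < n ] g x y
    eq : ∑[ x < suc n ] ∑[ y < suc n ] f x y ≡ 2 * row + inner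
    eq = begin
      (f zero zero + row) + ∑[ x < n ] (f (suc x) zero + ∑[ y < n ] g x y)
        ≡⟨ cong₂ _+_ (cong (_+ row) (f-diag zero)) (∑-distrib-+ (λ x → f (suc x) zero) (λ x → ∑[ y < n ] g x y)) ⟩
      row + ((∑[ x < n ] f (suc x) zero) + inner)
        ≡⟨ cong (λ s → row + (s + inner)) (sum-cong-≗ (λ x → f-sym (suc x) zero)) ⟩
      row + (row + inner)
        ≡⟨ solve 2 (λ a b → a :+ (a :+ b) := con 2 :* a :+ b) refl row inner ⟩
      2 * row + inner ∎
      where open +-*-Solver

irrₜ-exact : ∀ {n} (G : Graph n) → irrₜ G * 2 ≡ ∑∣Δdeg∣ G
irrₜ-exact G = m/n*n≡m (2∣∑∑ (λ x y → ∣ deg G x - deg G y ∣)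
  (λ x y → ∣-∣-comm (deg G x) (deg G y)) (λ x → ∣n-n∣≡0 (deg G x)))

{-# OPTIONS --safe #-}

-- List the degrees as ys followed by z ones, all entries of ys being at least 2.
-- The degree sum 2n - 2 of a tree gives sum ys = 2 |ys| + (z - 2). If z = 2, all
-- degrees are at most 2 and a connected graph with this property and a leaf is a path.
-- If z = 3, then ys is a permutation of (3,2,…,2). If z ≥ 4, the pairs consisting of
-- a leaf and a non-leaf already contribute z (n - 2) ≥ 4n - 8 to the irregularity.

module Submission where

open import Defs
open import Data.List.Base using (_∷_; []; _++_; replicate)
open import Data.Nat.Base using (ℕ; _*_; _∸_; _≤_; _≥_)
open import Data.Product.Base using (_×_)
open import Function.Bundles using (_⇔_)
open import Relation.Binary.PropositionalEquality using (_≡_)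
open import Relation.Nullary.Negation using (¬_)

open import Data.Bool.Base using (if_then_else_; true; false)
open import Data.Fin.Base using (Fin; zero; suc; toℕ; punchIn; punchOut)
open import Data.Fin.Permutation using (insert; insert-punchIn; _⟨$⟩ʳ_) renaming (id to idₚ)
import Data.Fin.Properties as Fin
open import Data.List.Base using (List; [_]; length; map; filter; tabulate; allFin; lookup)
open import Data.List.Membership.Propositional using (_∈_)
open import Data.List.Membership.Propositional.Properties using (∈-∃++; ∈-lookup; ∈-allFin)
open import Data.List.Properties
  using (map-tabulate; length-map; length-tabulate; length-++;
    length-replicate; map-cong; map-++; map-∘; ++-assoc)
open import Data.List.Relation.Binary.Equality.Propositional using (≋⇒≡)
open import Data.List.Relation.Binary.Permutation.Propositional
  using (_↭_; ↭-refl; ↭-sym; ↭-trans; ↭-reflexive; prep; swap; ↭⇒↭ₛ)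
open import Data.List.Relation.Binary.Permutation.Propositional.Properties
  using (All-resp-↭; ↭-length; ++⁺ʳ; shift) renaming (map⁺ to ↭-map⁺)
open import Data.List.Relation.Unary.All as All using (All; []; _∷_)
import Data.List.Relation.Unary.All.Properties as All
open import Data.List.Relation.Unary.AllPairs using ([]; _∷_)
import Data.List.Membership.DecPropositional as DecMembership
open import Data.List.Relation.Unary.Linked using (Linked; []; [-]; _∷_)
import Data.List.Relation.Unary.Linked.Properties as Linked
open import Data.List.Relation.Unary.Sorted.TotalOrder.Properties using (↗↭↗⇒≋)
open import Data.List.Relation.Unary.Unique.Propositional using (Unique)
import Data.List.Relation.Unary.Unique.Propositional.Properties as Unique
open import Data.Nat.Base using (zero; suc; _+_; _<_; z≤n; s≤s; ∣_-_∣)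
open import Data.Nat.ListAction using (sum)
open import Data.Nat.ListAction.Properties using (sum-↭; sum-++)
open import Data.Nat.Properties
open import Algebra.Properties.CommutativeMonoid.Sum +-0-commutativeMonoid
  using (sum-remove; sum-replicate-zero)
open import Data.Nat.Tactic.RingSolver using (solve-∀)
open import Data.Product.Base using (∃; ∃₂; _,_; proj₁; proj₂)
open import Data.Sum.Base as Sum using (_⊎_; inj₁; inj₂)
open import Function.Base using (_∘_; id)
open import Function.Bundles using (Injection; mk⇔; _↔_)
open import Function.Properties.Inverse using (↔⇒↣)
open import Function.Construct.Composition using (_⇔-∘_)
open import Function.Definitions using (Injective)
open import Relation.Binary.Bundles using (DecTotalOrder)
open import Relation.Binary.Construct.Closure.ReflexiveTransitive using (Star; ε; _◅_; kleisliStar)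
open import Relation.Binary.Properties.DecTotalOrder ≤-decTotalOrder using (≥-decTotalOrder)
open import Data.List.Sort ≥-decTotalOrder using (sort-↭; sort-↗)
open import Relation.Binary.PropositionalEquality
  using (_≢_; refl; sym; trans; cong; cong₂; subst; subst₂; module ≡-Reasoning)
open import Relation.Nullary.Decidable using (Dec; yes; no; does)
open import Relation.Nullary.Negation using (contradiction)
open import Relation.Unary using (Decidable)

-- The irregularity of a list of numbers

row : ℕ → List ℕ → ℕ
row x ys = sum (map ∣ x -_∣ ys)

-- Two separate arguments let concatenations be expanded block by block. On the diagonal every
-- unordered pair of positions counts twice, so `spread xs xs` is twice the irregularity.
spread : List ℕ → List ℕ → ℕ
spread xs ys = sum (map (λ x → row x ys) xs)

row-++ : ∀ x ys zs → row x (ys ++ zs) ≡ row x ys + row x zs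
row-++ x ys zs = trans (cong sum (map-++ ∣ x -_∣ ys zs)) (sum-++ (map ∣ x -_∣ ys) _)

row-replicate : ∀ x k y → row x (replicate k y) ≡ k * ∣ x - y ∣
row-replicate x zero    y = refl
row-replicate x (suc k) y = cong (∣ x - y ∣ +_) (row-replicate x k y)

spread-++ˡ : ∀ xs ys zs → spread (xs ++ ys) zs ≡ spread xs zs + spread ys zs
spread-++ˡ xs ys zs =
  trans (cong sum (map-++ (λ x → row x zs) xs ys)) (sum-++ (map (λ x → row x zs) xs) _)

spread-replicateˡ : ∀ k x ys → spread (replicate k x) ys ≡ k * row x ys
spread-replicateˡ zero    x ys = refl
spread-replicateˡ (suc k) x ys = cong (row x ys +_) (spread-replicateˡ k x ys)

spread-[]ʳ : ∀ xs → spread xs [] ≡ 0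
spread-[]ʳ []       = refl
spread-[]ʳ (x ∷ xs) = spread-[]ʳ xs

spread-∷ʳ : ∀ xs y ys → spread xs (y ∷ ys) ≡ row y xs + spread xs ys
spread-∷ʳ []       y ys = refl
spread-∷ʳ (x ∷ xs) y ys = begin
  (∣ x - y ∣ + row x ys) + spread xs (y ∷ ys)
    ≡⟨ cong₂ (λ d s → (d + row x ys) + s) (∣-∣-comm x y) (spread-∷ʳ xs y ys) ⟩
  (∣ y - x ∣ + row x ys) + (row y xs + spread xs ys)
    ≡⟨ +-interchange ∣ y - x ∣ _ _ _ ⟩
  (∣ y - x ∣ + row y xs) + (row x ys + spread xs ys) ∎
  where
  open ≡-Reasoning
  +-interchange : ∀ a b c d → (a + b) + (c + d) ≡ (a + c) + (b + d)
  +-interchange = solve-∀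

spread-sym : ∀ xs ys → spread xs ys ≡ spread ys xs
spread-sym xs []       = spread-[]ʳ xs
spread-sym xs (y ∷ ys) = trans (spread-∷ʳ xs y ys) (cong (row y xs +_) (spread-sym xs ys))

-- The outer sum and each inner sum are invariant under permutation, so the irregularity may be
-- computed on any rearrangement of the degrees.
spread-cong-↭ : ∀ {xs ys} → xs ↭ ys → spread xs xs ≡ spread ys ys
spread-cong-↭ {xs} {ys} p = trans
  (sum-↭ (↭-map⁺ _ p))
  (cong sum (map-cong (λ x → sum-↭ (↭-map⁺ ∣ x -_∣ p)) ys))

-- Each entry `x` of `xs` lies at distance `x - 1` from each of the `z` ones. Moving the subtracted
-- ones to the left-hand side avoids truncated subtraction.
spread-ones : ∀ {xs} → All (1 ≤_) xs → ∀ z →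
  spread xs (replicate z 1) + length xs * z ≡ sum xs * z
spread-ones []                    z = refl
spread-ones {suc x ∷ xs} (_ ∷ ps) z = begin
  (row (suc x) (replicate z 1) + spread xs (replicate z 1)) + (z + length xs * z)
    ≡⟨ cong (λ r → (r + _) + (z + length xs * z)) (row-replicate (suc x) z 1) ⟩
  (z * ∣ x - 0 ∣ + spread xs (replicate z 1)) + (z + length xs * z)
    ≡⟨ cong (λ d → (z * d + _) + (z + length xs * z)) (∣-∣-identityʳ x) ⟩
  (z * x + spread xs (replicate z 1)) + (z + length xs * z)
    ≡⟨ rearrange z x _ (length xs * z) ⟩
  (z + x * z) + (spread xs (replicate z 1) + length xs * z)
    ≡⟨ cong ((z + x * z) +_) (spread-ones ps z) ⟩
  (z + x * z) + sum xs * z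
    ≡⟨ *-distribʳ-+ z (suc x) (sum xs) ⟨
  (suc x + sum xs) * z ∎
  where
  open ≡-Reasoning
  rearrange : ∀ z x s l → (z * x + s) + (z + l) ≡ (z + x * z) + (s + l)
  rearrange = solve-∀

-- Of the four blocks of the right-hand side, the two diagonal ones are dropped; the two mixed ones
-- are equal by symmetry.
spread-++-≥ : ∀ xs ys → spread xs ys + spread xs ys ≤ spread (xs ++ ys) (xs ++ ys)
spread-++-≥ xs ys = begin
  spread xs ys + spread xs ys
    ≡⟨ cong₂ _+_ (spread-sym xs ys) refl ⟩
  spread ys xs + spread xs ys
    ≤⟨ m≤n+m _ (spread xs xs) ⟩
  spread xs xs + (spread ys xs + spread xs ys)
    ≡⟨ +-assoc (spread xs xs) _ _ ⟨
  (spread xs xs + spread ys xs) + spread xs ys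
    ≤⟨ m≤m+n _ (spread ys ys) ⟩
  ((spread xs xs + spread ys xs) + spread xs ys) + spread ys ys
    ≡⟨ +-assoc (spread xs xs + spread ys xs) _ _ ⟩
  (spread xs xs + spread ys xs) + (spread xs ys + spread ys ys)
    ≡⟨ cong₂ _+_ (split xs) (split ys) ⟨
  spread (xs ++ ys) xs + spread (xs ++ ys) ys
    ≡⟨ cong₂ _+_ (spread-sym (xs ++ ys) xs) (spread-sym (xs ++ ys) ys) ⟩
  spread xs (xs ++ ys) + spread ys (xs ++ ys)
    ≡⟨ spread-++ˡ xs ys (xs ++ ys) ⟨
  spread (xs ++ ys) (xs ++ ys) ∎
  where
  open ≤-Reasoning
  split : ∀ zs → spread (xs ++ ys) zs ≡ spread xs zs + spread ys zs
  split = spread-++ˡ xs ys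

minimal : ℕ → List ℕ
minimal k = 3 ∷ replicate k 2 ++ 1 ∷ 1 ∷ 1 ∷ []

-- With `n = k + 4` entries the value is `2 * (4 * n - 10)`, the doubled bound.
spread-minimal : ∀ k → spread (minimal k) (minimal k) ≡ 8 * k + 12
spread-minimal k = begin
  row 3 m + spread (replicate k 2 ++ 1 ∷ 1 ∷ 1 ∷ []) m
    ≡⟨ cong (row 3 m +_) (spread-++ˡ (replicate k 2) (1 ∷ 1 ∷ 1 ∷ []) m) ⟩
  row 3 m + (spread (replicate k 2) m + spread (1 ∷ 1 ∷ 1 ∷ []) m)
    ≡⟨ cong (λ s → row 3 m + (s + spread (1 ∷ 1 ∷ 1 ∷ []) m)) (spread-replicateˡ k 2 m) ⟩
  row 3 m + (k * row 2 m + (row 1 m + (row 1 m + (row 1 m + 0))))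
    ≡⟨ cong₂ _+_ (row-minimal 3)
         (cong₂ (λ r₂ r₁ → k * r₂ + (r₁ + (r₁ + (r₁ + 0)))) (row-minimal 2) (row-minimal 1)) ⟩
  -- The rows of 3, 2 and 1, in the form to which the right-hand side of `row-minimal` computes.
  (k * 1 + 6) + (k * (1 + (k * 0 + 3)) + ((2 + (k * 1 + 0)) + ((2 + (k * 1 + 0)) + ((2 + (k * 1 + 0)) + 0))))
    ≡⟨ simplify k ⟩
  8 * k + 12 ∎
  where
  open ≡-Reasoning
  m = minimal k
  row-minimal : ∀ x → row x m ≡ ∣ x - 3 ∣ + (k * ∣ x - 2 ∣ + row x (1 ∷ 1 ∷ 1 ∷ []))
  row-minimal x = cong (∣ x - 3 ∣ +_) (trans (row-++ x (replicate k 2) _)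
    (cong (_+ row x (1 ∷ 1 ∷ 1 ∷ [])) (row-replicate x k 2)))
  simplify : ∀ k → (k * 1 + 6) + (k * (1 + (k * 0 + 3)) + ((2 + (k * 1 + 0)) + ((2 + (k * 1 + 0)) + ((2 + (k * 1 + 0)) + 0)))) ≡ 8 * k + 12
  simplify = solve-∀

-- Lists whose sum is twice their length minus two

sum≥length*2 : ∀ {ys} → All (2 ≤_) ys → length ys * 2 ≤ sum ys
sum≥length*2 []       = z≤n
sum≥length*2 (p ∷ ps) = +-mono-≤ p (sum≥length*2 ps)

split-ones : ∀ {xs} → All (1 ≤_) xs → ∃₂ λ ys z → All (2 ≤_) ys × xs ↭ ys ++ replicate z 1
split-ones []                              = [] , 0 , [] , ↭-refl
split-ones {suc zero    ∷ xs} (_ ∷ ps) with ys , z , qs , π ← split-ones ps =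
  ys , suc z , qs , ↭-trans (prep 1 π) (↭-sym (shift 1 ys (replicate z 1)))
split-ones {suc (suc x) ∷ xs} (_ ∷ ps) with ys , z , qs , π ← split-ones ps =
  suc (suc x) ∷ ys , z , s≤s (s≤s z≤n) ∷ qs , prep (suc (suc x)) π

-- A head above 2 would leave the tail a sum below twice its length, contrary to `sum≥length*2`.
sum≡length*2⇒twos : ∀ {ys} → All (2 ≤_) ys → sum ys ≡ length ys * 2 → ys ≡ replicate (length ys) 2
sum≡length*2⇒twos []                                           eq = refl
sum≡length*2⇒twos {suc (suc x) ∷ ys} (s≤s (s≤s z≤n) ∷ ps) eq with x
... | zero  = cong (2 ∷_) (sum≡length*2⇒twos ps (suc-injective (suc-injective eq)))
... | suc a = contradiction (sum≥length*2 ps)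
  (<⇒≱ (subst (sum ys <_) (suc-injective (suc-injective eq)) (s≤s (m≤n+m (sum ys) a))))

-- There is a single unit of excess over 2. A head 2 passes it on to the tail, a head 3 consumes it
-- and forces twos afterwards, and a larger head exceeds it.
sum≡1+length*2⇒three : ∀ {ys} → All (2 ≤_) ys → sum ys ≡ 1 + length ys * 2 →
  ∃ λ k → ys ↭ 3 ∷ replicate k 2
sum≡1+length*2⇒three {suc (suc x) ∷ ys} (s≤s (s≤s z≤n) ∷ ps) eq with x
... | zero with k , π ← sum≡1+length*2⇒three ps (suc-injective (suc-injective eq)) =
  suc k , ↭-trans (prep 2 π) (swap 2 3 ↭-refl)
... | suc zero = length ys , prep 3 (↭-reflexive
  (sum≡length*2⇒twos ps (suc-injective (suc-injective (suc-injective eq)))))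
... | suc (suc a) = contradiction (sum≥length*2 ps)
  (<⇒≱ (subst (sum ys <_) (suc-injective (suc-injective (suc-injective eq))) (s≤s (m≤n+m (sum ys) a))))

data Shape (xs : List ℕ) : Set where
  all≤2   : All (_≤ 2) xs → Shape xs
  extremal : ∀ k → xs ↭ minimal k → Shape xs
  -- That is, the irregularity is at least `4 * n - 8`, doubled and free of subtraction.
  large   : 8 * length xs ≤ 16 + spread xs xs → Shape xs

shape : ∀ {xs} → All (1 ≤_) xs → sum xs + 2 ≡ length xs * 2 → Shape xs
-- The number of ones is passed on together with the two facts that mention it, so that matching on
-- it refines both.
shape {xs} pos eq with ys , leaves , ≥2 , π ← split-ones pos = by-leaves leaves π sum-eq
  where
  L = length ys
  S = sum ys

  sum-ones : ∀ z → sum (replicate z 1) ≡ z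
  sum-ones zero    = refl
  sum-ones (suc z) = cong suc (sum-ones z)

  length-eq : ∀ {z} → xs ↭ ys ++ replicate z 1 → length xs ≡ L + z
  length-eq {z} π = trans (↭-length π) (trans (length-++ ys) (cong (L +_) (length-replicate z)))

  sum-eq : S + 2 ≡ L * 2 + leaves
  sum-eq = +-cancelˡ-≡ leaves _ _ (begin
    leaves + (S + 2)                    ≡⟨ rearrange leaves S ⟩
    (S + leaves) + 2                    ≡⟨ cong (λ t → (S + t) + 2) (sum-ones leaves) ⟨
    (S + sum (replicate leaves 1)) + 2  ≡⟨ cong (_+ 2) (sum-++ ys (replicate leaves 1)) ⟨
    sum (ys ++ replicate leaves 1) + 2  ≡⟨ cong (_+ 2) (sum-↭ π) ⟨
    sum xs + 2                          ≡⟨ eq ⟩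
    length xs * 2                       ≡⟨ cong (_* 2) (length-eq π) ⟩
    (L + leaves) * 2                    ≡⟨ rearrange′ L leaves ⟩
    leaves + (L * 2 + leaves)           ∎)
    where
    open ≡-Reasoning
    rearrange : ∀ z s → z + (s + 2) ≡ (s + z) + 2
    rearrange = solve-∀
    rearrange′ : ∀ l z → (l + z) * 2 ≡ z + (l * 2 + z)
    rearrange′ = solve-∀

  sum-excess : ∀ {m} → S + 2 ≡ L * 2 + suc (suc m) → S ≡ m + L * 2
  sum-excess {m} eq = +-cancelʳ-≡ 2 S _ (trans eq (rearrange (L * 2) m))
    where
    rearrange : ∀ a m → a + (2 + m) ≡ (m + a) + 2
    rearrange = solve-∀

  -- Since `S` is at least `L * 2`, fewer than two ones cannot balance the equation.
  too-few : ∀ {z} → z < 2 → S + 2 ≢ L * 2 + z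
  too-few {z} z<2 eq = <-irrefl (sym eq) (+-mono-≤-< (sum≥length*2 ≥2) z<2)

  by-leaves : ∀ z → xs ↭ ys ++ replicate z 1 → S + 2 ≡ L * 2 + z → Shape xs
  by-leaves 0 π eq = contradiction eq (too-few (s≤s z≤n))
  by-leaves 1 π eq = contradiction eq (too-few (s≤s (s≤s z≤n)))
  by-leaves 2 π eq = all≤2 (All-resp-↭ (↭-sym π) (All.++⁺
    (subst (All (_≤ 2)) (sym (sum≡length*2⇒twos ≥2 (sum-excess {0} eq)))
      (All.replicate⁺ L ≤-refl))
    (All.replicate⁺ 2 (s≤s z≤n))))
  by-leaves 3 π eq with k , ρ ← sum≡1+length*2⇒three ≥2 (sum-excess {1} eq) =
    extremal k (↭-trans π (++⁺ʳ (replicate 3 1) ρ))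
  by-leaves (suc (suc (suc (suc m)))) π eq = large (begin
    8 * length xs              ≡⟨ cong (8 *_) (length-eq π) ⟩
    8 * (L + z)                ≡⟨ rearrange L m ⟩
    -- Here `2 + m + L` is `length xs` less 2, and the factor 4 is replaced by the actual number `z`
    -- of ones.
    16 + 2 * (4 * (2 + m + L)) ≤⟨ +-monoʳ-≤ 16 (*-monoʳ-≤ 2 (*-monoˡ-≤ (2 + m + L) (m≤m+n 4 m))) ⟩
    16 + 2 * (z * (2 + m + L)) ≡⟨ cong (16 +_) (cong (2 *_) cross) ⟨
    16 + 2 * C                 ≡⟨ cong (λ c → 16 + (C + c)) (+-identityʳ C) ⟩
    16 + (C + C)               ≤⟨ +-monoʳ-≤ 16 (spread-++-≥ ys (replicate z 1)) ⟩
    16 + spread zs zs          ≡⟨ cong (16 +_) (spread-cong-↭ π) ⟨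
    16 + spread xs xs          ∎)
    where
    open ≤-Reasoning
    z  = 4 + m
    zs = ys ++ replicate z 1
    C  = spread ys (replicate z 1)
    rearrange : ∀ l m → 8 * (l + (4 + m)) ≡ 16 + 2 * (4 * (2 + m + l))
    rearrange = solve-∀
    rearrange′ : ∀ l m → (2 + m + l * 2) * (4 + m) ≡ (4 + m) * (2 + m + l) + l * (4 + m)
    rearrange′ = solve-∀
    -- `spread-ones` gives `C + L * z ≡ S * z`; substituting `S ≡ 2 + m + L * 2` and cancelling
    -- `L * z` leaves the claim.
    cross : C ≡ z * (2 + m + L)
    cross = +-cancelʳ-≡ (L * z) C _ (trans (spread-ones (All.map (≤-trans (s≤s z≤n)) ≥2) z)
      (trans (cong (_* z) (sum-excess {2 + m} eq)) (rearrange′ L m)))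

-- Degrees as sums of adjacency indicators

𝟙 : ∀ {P : Set} → Dec P → ℕ
𝟙 d = if does d then 1 else 0

𝟙-yes : ∀ {P : Set} (d : Dec P) → P → 𝟙 d ≡ 1
𝟙-yes (yes _) _ = refl
𝟙-yes (no ¬p) p = contradiction p ¬p

𝟙-no : ∀ {P : Set} (d : Dec P) → ¬ P → 𝟙 d ≡ 0
𝟙-no (yes p) ¬p = contradiction p ¬p
𝟙-no (no _)  _  = refl

𝟙-cong : ∀ {P Q : Set} (d : Dec P) (e : Dec Q) → (P → Q) → (Q → P) → 𝟙 d ≡ 𝟙 e
𝟙-cong (yes p) e f g = sym (𝟙-yes e (f p))
𝟙-cong (no ¬p) e f g = sym (𝟙-no e (¬p ∘ g))

𝟙≤1 : ∀ {P : Set} (d : Dec P) → 𝟙 d ≤ 1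
𝟙≤1 (yes _) = ≤-refl
𝟙≤1 (no _)  = z≤n

term≤∑ : ∀ {n} (f : Fin n → ℕ) i → f i ≤ ∑[ j < n ] f j
term≤∑ f zero    = m≤m+n _ _
term≤∑ f (suc i) = ≤-trans (term≤∑ (f ∘ suc) i) (m≤n+m _ _)

length-filter-tabulate : ∀ {A : Set} {P : A → Set} (P? : Decidable P) {n} (f : Fin n → A) →
  length (filter P? (tabulate f)) ≡ ∑[ i < n ] 𝟙 (P? (f i))
length-filter-tabulate P? {zero}  f = refl
length-filter-tabulate P? {suc n} f with does (P? (f zero))
... | true  = cong suc (length-filter-tabulate P? (f ∘ suc))
... | false = length-filter-tabulate P? (f ∘ suc)

deg≡∑ : ∀ {n} (G : Graph n) v → deg G v ≡ ∑[ w < n ] 𝟙 (adj? G v w)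
deg≡∑ G v = length-filter-tabulate (adj? G v) id

deg-split : ∀ {n} (G : Graph (suc n)) v w →
  deg G v ≡ 𝟙 (adj? G v w) + ∑[ u < n ] 𝟙 (adj? G v (punchIn w u))
deg-split G v w = trans (deg≡∑ G v) (sum-remove {i = w} (λ u → 𝟙 (adj? G v u)))

neighbour⇒deg≥1 : ∀ {n} (G : Graph n) {v w} → Adj G v w → 1 ≤ deg G v
neighbour⇒deg≥1 G {v} {w} e = subst₂ _≤_ (𝟙-yes (adj? G v w) e) (sym (deg≡∑ G v))
  (term≤∑ (λ u → 𝟙 (adj? G v u)) w)

-- Distinct neighbours `a` and `b` give two indicators equal to 1: one is split off at `a`, the
-- other is a term of the remaining sum.
deg≤1⇒neighbour-unique : ∀ {n} (G : Graph (suc n)) {v a b} →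
  deg G v ≤ 1 → Adj G v a → Adj G v b → a ≡ b
deg≤1⇒neighbour-unique {n} G {v} {a} {b} d≤1 ea eb with a Fin.≟ b
... | yes a≡b = a≡b
... | no  a≢b = contradiction d≤1 (<⇒≱ (begin-strict
  1 <⟨ +-mono-≤ (≤-reflexive (sym (𝟙-yes (adj? G v a) ea))) (≤-reflexive (sym 𝟙b)) ⟩
  𝟙 (adj? G v a) + 𝟙 (adj? G v (punchIn a (punchOut a≢b)))
    ≤⟨ +-monoʳ-≤ _ (term≤∑ (λ u → 𝟙 (adj? G v (punchIn a u))) (punchOut a≢b)) ⟩
  𝟙 (adj? G v a) + ∑[ u < n ] 𝟙 (adj? G v (punchIn a u)) ≡⟨ deg-split G v a ⟨
  deg G v ∎))
  where
  open ≤-Reasoning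
  𝟙b : 𝟙 (adj? G v (punchIn a (punchOut a≢b))) ≡ 1
  𝟙b = 𝟙-yes (adj? G v _) (subst (Adj G v) (sym (Fin.punchIn-punchOut a≢b)) eb)

-- If no vertex other than `p` were adjacent to `v`, every term but the indicator at `p` would
-- vanish, leaving a degree of at most 1.
deg≥2⇒neighbour-≢ : ∀ {n} (G : Graph (suc n)) {v} → 2 ≤ deg G v → ∀ p → ∃ λ w → w ≢ p × Adj G v w
deg≥2⇒neighbour-≢ {n} G {v} d≥2 p with Fin.any? (λ u → adj? G v (punchIn p u))
... | yes (u , e) = punchIn p u , Fin.punchInᵢ≢i p u , e
... | no  ¬e      = contradiction d≥2 (<⇒≱ (s≤s (begin
  deg G v                                                  ≡⟨ deg-split G v p ⟩
  𝟙 (adj? G v p) + ∑[ u < n ] 𝟙 (adj? G v (punchIn p u))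
    ≡⟨ cong (𝟙 (adj? G v p) +_) (sum-cong-≗ (λ u → 𝟙-no (adj? G v (punchIn p u)) (λ e → ¬e (u , e)))) ⟩
  𝟙 (adj? G v p) + ∑[ u < n ] 0                            ≡⟨ cong (𝟙 (adj? G v p) +_) (sum-replicate-zero n) ⟩
  𝟙 (adj? G v p) + 0                                       ≡⟨ +-identityʳ _ ⟩
  𝟙 (adj? G v p)                                           ≤⟨ 𝟙≤1 (adj? G v p) ⟩
  1                                                        ∎)))
  where open ≤-Reasoning

-- Deleting a vertex

infixl 6 _∖_

_∖_ : ∀ {n} → Graph (suc n) → Fin (suc n) → Graph n
G ∖ v = record
  { Adj    = λ u w → Adj G (punchIn v u) (punchIn v w)
  ; adj?   = λ u w → adj? G (punchIn v u) (punchIn v w)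
  ; symm   = symm G
  ; irrefl = irrefl G
  }

deg-∖ : ∀ {n} (G : Graph (suc n)) v u →
  deg G (punchIn v u) ≡ 𝟙 (adj? G (punchIn v u) v) + deg (G ∖ v) u
deg-∖ G v u = trans (deg-split G (punchIn v u) v)
  (cong (𝟙 (adj? G (punchIn v u) v) +_) (sym (deg≡∑ (G ∖ v) u)))

-- Each edge at `v` is lost twice: once in the degree of `v` and once in the degree of the
-- neighbour.
∑deg-∖ : ∀ {n} (G : Graph (suc n)) v →
  ∑[ u < suc n ] deg G u ≡ 2 * deg G v + ∑[ u < n ] deg (G ∖ v) u
∑deg-∖ {n} G v = begin
  ∑[ u < suc n ] deg G u
    ≡⟨ sum-remove {i = v} (deg G) ⟩
  deg G v + ∑[ u < n ] deg G (punchIn v u)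
    ≡⟨ cong (deg G v +_) (sum-cong-≗ (deg-∖ G v)) ⟩
  deg G v + ∑[ u < n ] (𝟙 (adj? G (punchIn v u) v) + deg (G ∖ v) u)
    ≡⟨ cong (deg G v +_) (∑-distrib-+ (λ u → 𝟙 (adj? G (punchIn v u) v)) (deg (G ∖ v))) ⟩
  deg G v + ((∑[ u < n ] 𝟙 (adj? G (punchIn v u) v)) + rest)
    ≡⟨ cong (λ s → deg G v + (s + rest)) into-v ⟩
  deg G v + (deg G v + rest)
    ≡⟨ rearrange (deg G v) rest ⟩
  2 * deg G v + rest ∎
  where
  open ≡-Reasoning
  rest = ∑[ u < n ] deg (G ∖ v) u
  rearrange : ∀ d r → d + (d + r) ≡ 2 * d + r
  rearrange = solve-∀
  -- Symmetry turns edges into `v` to edges out of `v`; the missing term at `v` itself is zero by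
  -- irreflexivity.
  into-v : ∑[ u < n ] 𝟙 (adj? G (punchIn v u) v) ≡ deg G v
  into-v = begin
    ∑[ u < n ] 𝟙 (adj? G (punchIn v u) v)
      ≡⟨ sum-cong-≗ (λ u → 𝟙-cong (adj? G (punchIn v u) v) (adj? G v (punchIn v u)) (symm G) (symm G)) ⟩
    ∑[ u < n ] 𝟙 (adj? G v (punchIn v u))
      ≡⟨ cong (_+ ∑[ u < n ] 𝟙 (adj? G v (punchIn v u))) (𝟙-no (adj? G v v) (irrefl G)) ⟨
    𝟙 (adj? G v v) + ∑[ u < n ] 𝟙 (adj? G v (punchIn v u))
      ≡⟨ deg-split G v v ⟨
    deg G v ∎

connected⇒neighbour : ∀ {n} (G : Graph n) → Connected G → ∀ {u v} → u ≢ v → ∃ λ w → Adj G u w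
connected⇒neighbour G conn {u} {v} u≢v with conn u v
... | ε     = contradiction refl u≢v
... | e ◅ _ = _ , e

∖-connected : ∀ {n} (G : Graph (suc n)) {v} → Connected G → deg G v ≤ 1 → Connected (G ∖ v)
∖-connected {n} G {v} conn d≤1 a b =
  subst₂ (Star (Adj (G ∖ v))) (retract-punchIn a) (retract-punchIn b)
    (kleisliStar retract retract-step (conn (punchIn v a) (punchIn v b)))
  where
  w : Fin (suc n)
  -- The vertex `a` of `G ∖ v` guarantees a vertex other than `v`, hence a neighbour of `v`.
  w = proj₁ (connected⇒neighbour G conn (Fin.punchInᵢ≢i v a ∘ sym))

  v~w : Adj G v w
  v~w = proj₂ (connected⇒neighbour G conn (Fin.punchInᵢ≢i v a ∘ sym))

  v≢w : v ≢ w
  v≢w v≡w = irrefl G (subst (Adj G v) (sym v≡w) v~w)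

  -- Moving the leaf v onto its neighbour w turns walks in G into walks in G ∖ v.
  retract : Fin (suc n) → Fin n
  retract u with v Fin.≟ u
  ... | yes _   = punchOut v≢w
  ... | no  v≢u = punchOut v≢u

  retract-punchIn : ∀ u → retract (punchIn v u) ≡ u
  retract-punchIn u with v Fin.≟ punchIn v u
  ... | yes eq = contradiction (sym eq) (Fin.punchInᵢ≢i v u)
  ... | no  _  = trans (Fin.punchOut-cong v refl) (Fin.punchOut-punchIn v)

  retract-step : ∀ {x y} → Adj G x y → Star (Adj (G ∖ v)) (retract x) (retract y)
  -- An edge at `v` has its other end at `w` by uniqueness, so it collapses to the empty walk; any
  -- other edge survives.
  retract-step {x} {y} e with v Fin.≟ x | v Fin.≟ y
  ... | yes refl | yes refl = ε
  ... | yes refl | no  v≢y  = subst (Star _ _)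
    (Fin.punchOut-cong v (deg≤1⇒neighbour-unique G d≤1 v~w e)) ε
  ... | no  v≢x  | yes refl = subst (λ z → Star _ z _)
    (Fin.punchOut-cong v (deg≤1⇒neighbour-unique G d≤1 v~w (symm G e))) ε
  ... | no  v≢x  | no  v≢y  = subst₂ (Adj G)
    (sym (Fin.punchIn-punchOut v≢x)) (sym (Fin.punchIn-punchOut v≢y)) e ◅ ε

∖-acyclic : ∀ {n} (G : Graph (suc n)) v → ¬ Cycle G → ¬ Cycle (G ∖ v)
∖-acyclic G v acyclic C = acyclic record
  { v        = punchIn v (Cycle.v C)
  ; vs       = map (punchIn v) (Cycle.vs C)
  ; length≥2 = subst (2 ≤_) (sym (length-map (punchIn v) (Cycle.vs C))) (Cycle.length≥2 C)
  ; distinct = Unique.map⁺ (Fin.punchIn-injective v _ _) (Cycle.distinct C)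
  ; closed   = subst (λ zs → Linked (Adj G) (punchIn v (Cycle.v C) ∷ zs))
      (map-++ (punchIn v) (Cycle.vs C) [ Cycle.v C ]) (Linked.map⁺ (Cycle.closed C))
  }

∖-isTree : ∀ {n} (G : Graph (suc n)) {v} → IsTree G → deg G v ≤ 1 → IsTree (G ∖ v)
∖-isTree G {v} T d≤1 = record
  { connected = ∖-connected G (IsTree.connected T) d≤1
  ; acyclic   = ∖-acyclic G v (IsTree.acyclic T)
  }

-- Trees have leaves

lookup-injective : ∀ {A : Set} {xs : List A} → Unique xs → Injective _≡_ _≡_ (lookup xs)
lookup-injective (x∉xs ∷ u) {zero}  {zero}  eq = refl
lookup-injective (x∉xs ∷ u) {zero}  {suc j} eq = contradiction eq (All.lookup x∉xs (∈-lookup j))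
lookup-injective (x∉xs ∷ u) {suc i} {zero}  eq = contradiction (sym eq) (All.lookup x∉xs (∈-lookup i))
lookup-injective (x∉xs ∷ u) {suc i} {suc j} eq = cong suc (lookup-injective u eq)

unique⇒length≤ : ∀ {n} {xs : List (Fin n)} → Unique xs → length xs ≤ n
unique⇒length≤ u = Fin.injective⇒≤ (lookup-injective u)

linked-close : ∀ {A : Set} {R : A → A → Set} {h w} xs {ys} →
  Linked R (xs ++ w ∷ ys) → R w h → Linked R (xs ++ w ∷ [ h ])
linked-close []           _         r = r ∷ [-]
linked-close (x ∷ [])     (p ∷ _)   r = p ∷ r ∷ [-]
linked-close (x ∷ y ∷ xs) (p ∷ ps)  r = p ∷ linked-close (y ∷ xs) ps r

unique-prefix : ∀ {A : Set} {w : A} xs {ys} → Unique (xs ++ w ∷ ys) → Unique (xs ++ [ w ])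
unique-prefix []       (_ ∷ _) = [] ∷ []
unique-prefix {w = w} (x ∷ xs) {ys} (p ∷ ps) =
  All.++⁺ (All.++⁻ˡ xs p) (All.head (All.++⁻ʳ xs p) ∷ []) ∷ unique-prefix xs ps

-- The path is cut after `w` and closed by the edge back to `h`. As `w` lies beyond `p`, the cycle
-- has at least two vertices besides `h`.
chord⇒cycle : ∀ {n} (G : Graph n) {h p w xs} → Unique (h ∷ p ∷ xs) → Linked (Adj G) (h ∷ p ∷ xs) →
  w ∈ xs → Adj G w h → Cycle G
chord⇒cycle G {h} {p} {w} uniq link w∈xs e with ys , zs , refl ← ∈-∃++ w∈xs = record
  { v        = h
  ; vs       = p ∷ ys ++ [ w ]
  ; length≥2 = s≤s (subst (1 ≤_) (sym (length-++ ys)) (m≤n+m 1 (length ys)))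
  ; distinct = unique-prefix (h ∷ p ∷ ys) uniq
  ; closed   = subst (λ l → Linked (Adj G) (h ∷ p ∷ l)) (sym (++-assoc ys [ w ] [ h ]))
      (linked-close (h ∷ p ∷ ys) link e)
  }

-- Without leaves the end h of a path can always be continued: a neighbour of h other
-- than its predecessor is either new or closes a cycle.
long-path : ∀ {n} {G : Graph (suc (suc n))} → IsTree G → (∀ v → 2 ≤ deg G v) → ∀ k →
  ∃₂ λ h p → ∃ λ xs → Unique (h ∷ p ∷ xs) × Linked (Adj G) (h ∷ p ∷ xs) × length xs ≡ k
long-path {G = G} T d≥2 zero with w , e ← connected⇒neighbour G (IsTree.connected T) {zero} {suc zero} (λ ()) =
  w , zero , [] , ((λ { refl → irrefl G e }) ∷ []) ∷ [] ∷ [] , symm G e ∷ [-] , refl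
long-path {G = G} T d≥2 (suc k)
  with h , p , xs , uniq , link , refl ← long-path T d≥2 k
  with w , w≢p , e ← deg≥2⇒neighbour-≢ G (d≥2 h) p
  with w ∈? xs
  where open DecMembership Fin._≟_ using (_∈?_)
... | yes w∈xs = contradiction (chord⇒cycle G uniq link w∈xs (symm G e)) (IsTree.acyclic T)
... | no  w∉xs = w , h , p ∷ xs ,
  ((λ { refl → irrefl G e }) ∷ w≢p ∷ All.¬Any⇒All¬ xs w∉xs) ∷ uniq , symm G e ∷ link , refl

tree-deg≥1 : ∀ {n} {G : Graph (suc (suc n))} → IsTree G → ∀ v → 1 ≤ deg G v
tree-deg≥1 {G = G} T v = neighbour⇒deg≥1 G (proj₂ (connected⇒neighbour G (IsTree.connected T)
  (Fin.punchInᵢ≢i v zero ∘ sym)))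

-- Without a leaf all degrees would be at least 2, and `long-path` at `suc n` would give `n + 3`
-- distinct vertices among only `n + 2`.
leaf-exists : ∀ {n} {G : Graph (suc (suc n))} → IsTree G → ∃ λ v → deg G v ≡ 1
leaf-exists {n} {G} T with Fin.any? (λ v → deg G v ≟ 1)
... | yes leaf = leaf
... | no  none
  with h , p , xs , uniq , _ , eq ← long-path T
         (λ v → ≤∧≢⇒< (tree-deg≥1 T v) (λ 1≡d → none (v , sym 1≡d))) (suc n) =
  contradiction (unique⇒length≤ uniq) (<⇒≱ (subst (λ l → suc (suc n) < 2 + l) (sym eq) ≤-refl))

-- Induction by removing a leaf, which lowers the degree sum by 2 and leaves a tree; a single vertex
-- has degree 0.
∑deg-tree : ∀ {n} {G : Graph (suc n)} → IsTree G → (∑[ v < suc n ] deg G v) + 2 ≡ suc n * 2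
∑deg-tree {zero}  {G} T = cong (λ d → d + 0 + 2)
  (trans (deg≡∑ G zero) (cong (_+ 0) (𝟙-no (adj? G zero zero) (irrefl G))))
∑deg-tree {suc n} {G} T with v , d≡1 ← leaf-exists T = begin
  (∑[ u < suc (suc n) ] deg G u) + 2            ≡⟨ cong (_+ 2) (∑deg-∖ G v) ⟩
  (2 * deg G v + ∑[ u < suc n ] deg (G ∖ v) u) + 2 ≡⟨ cong (λ d → (2 * d + ∑[ u < suc n ] deg (G ∖ v) u) + 2) d≡1 ⟩
  2 + ((∑[ u < suc n ] deg (G ∖ v) u) + 2)
    ≡⟨ cong (2 +_) (∑deg-tree (∖-isTree G T (≤-reflexive d≡1))) ⟩
  suc (suc n) * 2 ∎
  where open ≡-Reasoning

-- Connected graphs of maximum degree 2 with a leaf are paths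

punchIn-view : ∀ {n} (i j : Fin (suc n)) → j ≡ i ⊎ ∃ λ k → j ≡ punchIn i k
punchIn-view i j with i Fin.≟ j
... | yes eq  = inj₁ (sym eq)
... | no  i≢j = inj₂ (punchOut i≢j , sym (Fin.punchIn-punchOut i≢j))

insert-self : ∀ {m n} i j (π : Fin m ↔ Fin n) → insert i j π ⟨$⟩ʳ i ≡ j
insert-self i j π with i Fin.≟ i
... | yes _   = refl
... | no  i≢i = contradiction refl i≢i

P-suc : ∀ {n} (a b : Fin n) → Adj (P n) a b ⇔ Adj (P (suc n)) (suc a) (suc b)
P-suc a b = mk⇔ (Sum.map (cong suc) (cong suc)) (Sum.map suc-injective suc-injective)

P-zero : ∀ {n} (j : Fin (suc n)) → Adj (P (suc (suc n))) zero (suc j) → j ≡ zero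
P-zero j (inj₁ eq) = Fin.toℕ-injective (suc-injective eq)

-- The vertex `p` becomes the new end of the path and all other positions shift by one. Adjacency at
-- `p` is preserved because its only neighbour `q` was the old end.
extend-path : ∀ {n} (G : Graph (suc (suc n))) {p q} → deg G p ≤ 1 → Adj G p (punchIn p q) →
  (∃ λ (φ : G ∖ p ≅ P (suc n)) → proj₁ φ ⟨$⟩ʳ q ≡ zero) →
  ∃ λ (φ : G ≅ P (suc (suc n))) → proj₁ φ ⟨$⟩ʳ p ≡ zero
extend-path {n} G {p} {q} d≤1 p~q ((π , π-adj) , πq≡0) = (ψ , ψ-adj) , ψp≡0
  where
  ψ : Fin (suc (suc n)) ↔ Fin (suc (suc n))
  ψ = insert p zero π

  ψp≡0 : ψ ⟨$⟩ʳ p ≡ zero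
  ψp≡0 = insert-self p zero π

  ψ-punchIn : ∀ u → ψ ⟨$⟩ʳ punchIn p u ≡ suc (π ⟨$⟩ʳ u)
  ψ-punchIn = insert-punchIn p zero π

  p-adj⇒ : ∀ b → Adj G p (punchIn p b) → Adj (P (suc (suc n))) zero (suc (π ⟨$⟩ʳ b))
  p-adj⇒ b e = inj₁ (cong (suc ∘ toℕ) (trans (cong (π ⟨$⟩ʳ_)
    (Fin.punchIn-injective p b q (deg≤1⇒neighbour-unique G d≤1 e p~q))) πq≡0))

  -- The only neighbour of `zero` has the form `suc zero`, so `b` and `q` have the same image under
  -- `π` and coincide.
  p-adj⇐ : ∀ b → Adj (P (suc (suc n))) zero (suc (π ⟨$⟩ʳ b)) → Adj G p (punchIn p b)
  p-adj⇐ b e = subst (Adj G p ∘ punchIn p)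
    (Injection.injective (↔⇒↣ π) (trans πq≡0 (sym (P-zero _ e)))) p~q

  ψ-adj : ∀ u v → Adj G u v ⇔ Adj (P (suc (suc n))) (ψ ⟨$⟩ʳ u) (ψ ⟨$⟩ʳ v)
  ψ-adj u v with punchIn-view p u | punchIn-view p v
  ... | inj₁ refl | inj₁ refl = mk⇔
    (λ e → contradiction e (irrefl G)) (λ e → contradiction e (irrefl (P (suc (suc n))) {ψ ⟨$⟩ʳ u}))
  ... | inj₁ refl | inj₂ (b , refl) =
    subst₂ (λ x y → Adj G u v ⇔ Adj (P _) x y) (sym ψp≡0) (sym (ψ-punchIn b))
      (mk⇔ (p-adj⇒ b) (p-adj⇐ b))
  ... | inj₂ (a , refl) | inj₁ refl =
    subst₂ (λ x y → Adj G u v ⇔ Adj (P _) x y) (sym (ψ-punchIn a)) (sym ψp≡0)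
      (mk⇔ (Sum.swap ∘ p-adj⇒ a ∘ symm G) (symm G ∘ p-adj⇐ a ∘ Sum.swap))
  ... | inj₂ (a , refl) | inj₂ (b , refl) =
    subst₂ (λ x y → Adj G u v ⇔ Adj (P _) x y) (sym (ψ-punchIn a)) (sym (ψ-punchIn b))
      (P-suc _ _ ⇔-∘ π-adj a b)

-- Recording that `p` goes to the end `zero` makes the induction work: once `p` is removed, its
-- neighbour `q` has lost an edge and is the next end. The bound `deg G p ≤ 1`, rather than
-- equality, also admits the single vertex reached last.
path-from-leaf : ∀ {n} (G : Graph (suc n)) → Connected G → (∀ v → deg G v ≤ 2) →
  ∀ p → deg G p ≤ 1 → ∃ λ (φ : G ≅ P (suc n)) → proj₁ φ ⟨$⟩ʳ p ≡ zero
path-from-leaf {zero} G conn d≤2 zero d≤1 = (idₚ , λ { zero zero → mk⇔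
  (λ e → contradiction e (irrefl G)) (λ e → contradiction e (irrefl (P 1) {zero})) }) , refl
path-from-leaf {suc n} G conn d≤2 p d≤1
  with w , p~w ← connected⇒neighbour G conn (Fin.punchInᵢ≢i p zero ∘ sym)
  with punchIn-view p w
... | inj₁ refl       = contradiction p~w (irrefl G)
... | inj₂ (q , refl) = extend-path G d≤1 p~w
  (path-from-leaf (G ∖ p) (∖-connected G conn d≤1) d′≤2 q d′q≤1)
  where
  d′≤2 : ∀ u → deg (G ∖ p) u ≤ 2
  d′≤2 u = ≤-trans (m≤n+m _ _) (subst (_≤ 2) (deg-∖ G p u) (d≤2 (punchIn p u)))

  d′q≤1 : deg (G ∖ p) q ≤ 1
  d′q≤1 = ≤-pred (subst (_≤ 2) (trans (deg-∖ G p q)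
    (cong (_+ deg (G ∖ p) q) (𝟙-yes (adj? G _ p) (symm G p~w)))) (d≤2 (punchIn p q)))

-- The degree list of a graph

degrees : ∀ {n} → Graph n → List ℕ
degrees {n} G = map (deg G) (allFin n)

∑≡sum : ∀ {n} (f : Fin n → ℕ) → ∑[ i < n ] f i ≡ sum (map f (allFin n))
∑≡sum f = trans (∑≡sum-tabulate f) (cong sum (sym (map-tabulate id f)))
  where
  ∑≡sum-tabulate : ∀ {n} (f : Fin n → ℕ) → ∑[ i < n ] f i ≡ sum (tabulate f)
  ∑≡sum-tabulate {zero}  f = refl
  ∑≡sum-tabulate {suc n} f = cong (f zero +_) (∑≡sum-tabulate (f ∘ suc))

irrₜ-spread : ∀ {n} (G : Graph n) → irrₜ G * 2 ≡ spread (degrees G) (degrees G)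
irrₜ-spread {n} G = begin
  irrₜ G * 2
    ≡⟨ irrₜ-exact G ⟩
  ∑[ x < n ] ∑[ y < n ] ∣ deg G x - deg G y ∣
    ≡⟨ sum-cong-≗ (λ x → trans (∑≡sum (λ y → ∣ deg G x - deg G y ∣))
         (cong sum (map-∘ {g = ∣ deg G x -_∣} (allFin n)))) ⟩
  ∑[ x < n ] row (deg G x) (degrees G)
    ≡⟨ ∑≡sum (λ x → row (deg G x) (degrees G)) ⟩
  sum (map (λ x → row (deg G x) (degrees G)) (allFin n))
    ≡⟨ cong sum (map-∘ (allFin n)) ⟩
  spread (degrees G) (degrees G) ∎
  where open ≡-Reasoning

length-degrees : ∀ {n} (G : Graph n) → length (degrees G) ≡ n
length-degrees {n} G = trans (length-map (deg G) (allFin n)) (length-tabulate id)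

degrees-shape : ∀ {n} (G : Graph n) → (∀ v → 1 ≤ deg G v) → (∑[ v < n ] deg G v) + 2 ≡ n * 2 →
  Shape (degrees G)
degrees-shape {n} G d≥1 ∑d = shape (All.map⁺ (All.tabulate (λ {v} _ → d≥1 v))) (begin
  sum (degrees G) + 2            ≡⟨ cong (_+ 2) (∑≡sum (deg G)) ⟨
  (∑[ v < n ] deg G v) + 2       ≡⟨ ∑d ⟩
  n * 2                          ≡⟨ cong (_* 2) (length-degrees G) ⟨
  length (degrees G) * 2         ∎)
  where open ≡-Reasoning

minimal-nonincreasing : ∀ k → Linked _≥_ (minimal k)
minimal-nonincreasing zero    = s≤s z≤n ∷ ≤-refl ∷ ≤-refl ∷ [-]
minimal-nonincreasing (suc k) = s≤s (s≤s z≤n) ∷ twos k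
  where
  twos : ∀ k → Linked _≥_ (2 ∷ replicate k 2 ++ 1 ∷ 1 ∷ 1 ∷ [])
  twos zero    = s≤s z≤n ∷ ≤-refl ∷ ≤-refl ∷ [-]
  twos (suc k) = ≤-refl ∷ twos k

-- Two sorted lists that are permutations of each other are equal.
degreeSequence≡ : ∀ {n} {G : Graph n} {ds} → Linked _≥_ ds → degrees G ↭ ds → degreeSequence G ≡ ds
degreeSequence≡ {G = G} ds↘ π = ≋⇒≡ (↗↭↗⇒≋ (DecTotalOrder.totalOrder ≥-decTotalOrder)
  (sort-↗ (degrees G)) ds↘ (↭⇒↭ₛ (↭-trans (sort-↭ (degrees G)) π)))

length-minimal : ∀ k → length (minimal k) ≡ k + 4
length-minimal k = begin
  suc (length (replicate k 2 ++ 1 ∷ 1 ∷ 1 ∷ []))  ≡⟨ cong suc (length-++ (replicate k 2)) ⟩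
  suc (length (replicate k 2) + 3)                ≡⟨ cong (λ l → suc (l + 3)) (length-replicate k) ⟩
  suc (k + 3)                                     ≡⟨ +-suc k 3 ⟨
  k + 4                                           ∎
  where open ≡-Reasoning

-- Trees other than paths: the lower bound and the case of equality

≤2-tree-path : ∀ {n} (G : Graph (suc (suc n))) → IsTree G → (∀ v → deg G v ≤ 2) → G ≅ P (suc (suc n))
≤2-tree-path G T d≤2 with v , d≡1 ← leaf-exists T =
  proj₁ (path-from-leaf G (IsTree.connected T) d≤2 v (≤-reflexive d≡1))

degrees-cases : ∀ {n} (G : Graph n) → (∀ v → 1 ≤ deg G v) → (∑[ v < n ] deg G v) + 2 ≡ n * 2 →
  ¬ (∀ v → deg G v ≤ 2) → degrees G ↭ minimal (n ∸ 4) ⊎ 8 * n ≤ 16 + irrₜ G * 2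
degrees-cases {n} G d≥1 ∑d d≰2 with degrees-shape G d≥1 ∑d
... | all≤2 ds≤2   = contradiction (λ v → All.lookup (All.map⁻ ds≤2) (∈-allFin v)) d≰2
... | extremal k π = inj₁ (subst (λ k → degrees G ↭ minimal k) k≡ π)
  where
  -- The number of twos is determined by comparing lengths: `k + 4` entries against `n` vertices.
  k≡ : k ≡ n ∸ 4
  k≡ = trans (sym (m+n∸n≡m k 4)) (cong (_∸ 4)
    (trans (sym (length-minimal k)) (trans (sym (↭-length π)) (length-degrees G))))
... | large 8n≤    =
  inj₂ (subst₂ (λ l s → 8 * l ≤ 16 + s) (length-degrees G) (sym (irrₜ-spread G)) 8n≤)

nonpath-tree-cases : ∀ {n} (G : Graph n) → 2 ≤ n → IsTree G → ¬ (G ≅ P n) →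
  degrees G ↭ minimal (n ∸ 4) ⊎ 8 * n ≤ 16 + irrₜ G * 2
nonpath-tree-cases {suc (suc n)} G (s≤s (s≤s z≤n)) T ≇P =
  degrees-cases G (tree-deg≥1 T) (∑deg-tree T) (≇P ∘ ≤2-tree-path G T)

-- Writing `n` as `4 + i` makes both truncated subtractions exact. The right-hand side is the value
-- in `spread-minimal` at `n ∸ 4`.
bound*2 : ∀ {n} → 4 ≤ n → (4 * n ∸ 10) * 2 ≡ 8 * (n ∸ 4) + 12
bound*2 {suc (suc (suc (suc i)))} (s≤s (s≤s (s≤s (s≤s _)))) =
  trans (cong (λ m → (m ∸ 10) * 2) (expand i)) (trans (cong (_* 2) (m+n∸m≡n 10 (6 + 4 * i))) (rearrange i))
  where
  expand : ∀ i → 4 * (4 + i) ≡ 10 + (6 + 4 * i)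
  expand = solve-∀
  rearrange : ∀ i → (6 + 4 * i) * 2 ≡ 8 * i + 12
  rearrange = solve-∀

8n≡20+bound*2 : ∀ {n} → 4 ≤ n → 8 * n ≡ 20 + (4 * n ∸ 10) * 2
8n≡20+bound*2 {suc (suc (suc (suc i)))} 4≤n@(s≤s (s≤s (s≤s (s≤s _)))) =
  trans (expand i) (cong (20 +_) (sym (bound*2 4≤n)))
  where
  expand : ∀ i → 8 * (4 + i) ≡ 20 + (8 * i + 12)
  expand = solve-∀

degrees-minimal⇒irrₜ : ∀ {n} → 4 ≤ n → (G : Graph n) → degrees G ↭ minimal (n ∸ 4) → irrₜ G ≡ 4 * n ∸ 10
degrees-minimal⇒irrₜ {n} 4≤n G π = *-cancelʳ-≡ (irrₜ G) (4 * n ∸ 10) 2 (begin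
  irrₜ G * 2                                  ≡⟨ irrₜ-spread G ⟩
  spread (degrees G) (degrees G)              ≡⟨ spread-cong-↭ π ⟩
  spread (minimal (n ∸ 4)) (minimal (n ∸ 4))  ≡⟨ spread-minimal (n ∸ 4) ⟩
  8 * (n ∸ 4) + 12                            ≡⟨ bound*2 4≤n ⟨
  (4 * n ∸ 10) * 2                            ∎)
  where open ≡-Reasoning

-- Since `8 * n` is 20 plus the doubled bound, the excess of 20 over 16 puts `r` at least 2 above
-- the bound. Strictness is what excludes equality when there are four or more leaves.
bound< : ∀ {n r} → 4 ≤ n → 8 * n ≤ 16 + r * 2 → 4 * n ∸ 10 < r
bound< {n} {r} 4≤n 8n≤ = ≤-trans (n≤1+n _) (*-cancelʳ-≤ (2 + (4 * n ∸ 10)) r 2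
  (+-cancelˡ-≤ 16 _ _ (subst (_≤ 16 + r * 2) (8n≡20+bound*2 4≤n) 8n≤)))

theorem6 : ∀ (n : ℕ) → n ≥ 5 → (G : Graph n) → IsTree G → ¬ (G ≅ P n) →
    irrₜ G ≥ 4 * n ∸ 10 ×
    (irrₜ G ≡ 4 * n ∸ 10 ⇔ degreeSequence G ≡ 3 ∷ replicate (n ∸ 4) 2 ++ 1 ∷ 1 ∷ 1 ∷ [])
theorem6 n n≥5 G T ≇P with nonpath-tree-cases G (≤-trans (s≤s (s≤s z≤n)) n≥5) T ≇P
... | inj₁ π =
  ≤-reflexive (sym irr≡) , mk⇔ (λ _ → degreeSequence≡ {G = G} (minimal-nonincreasing (n ∸ 4)) π) (λ _ → irr≡)
  where
  irr≡ : irrₜ G ≡ 4 * n ∸ 10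
  irr≡ = degrees-minimal⇒irrₜ (<⇒≤ n≥5) G π
-- Equality contradicts the strict bound. Conversely, sorting only permutes the degrees, so the
-- given sequence determines the irregularity.
... | inj₂ 8n≤ = <⇒≤ bound<irr , mk⇔
  (λ irr≡ → contradiction (sym irr≡) (<⇒≢ bound<irr))
  (λ seq≡ → degrees-minimal⇒irrₜ (<⇒≤ n≥5) G
    (↭-trans (↭-sym (sort-↭ (degrees G))) (↭-reflexive seq≡)))
  where
  bound<irr : 4 * n ∸ 10 < irrₜ G
  bound<irr = bound< (<⇒≤ n≥5) 8n≤
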